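{- For every positive integer $D$ and all integers $i,j$ with $0\le i,j\le D$, \[ \left| {}_4F_3\!\left[\begin{matrix} -i,\ i+1,\ -j,\ j+1\\ 1,\ D+2,\ -D\end{matrix};1\right]\right| \le 1 . \]
   Context: For a real number $a$ and a nonnegative integer $n$, $(a)_n=a(a+1)\cdots(a+n-1)$ (with $(a)_0=1$). For real $a_1,\dots,a_4,b_1,b_2,b_3$, ${}_4F_3\!\left[\begin{matrix} a_1,a_2,a_3,a_4\\ b_1,b_2,b_3\end{matrix};z\right]=\sum_{n\ge0}\frac{(a_1)_n(a_2)_n(a_3)_n(a_4)_n}{(b_1)_n(b_2)_n(b_3)_n}\frac{z^n}{n!}$. In the series above the factor $(-i)_n$ vanishes for $n>i$, so the sum is finite and runs over $0\le n\le \min(i,j)\le D$, where $(-D)_n\neq0$. -}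

module Defs where

open import Data.Nat as ℕ using (ℕ; zero; suc)
open import Data.Rational using (ℚ; 0ℚ; 1ℚ; _+_; _*_; _÷_; -_; ≢-nonZero)
import Data.Rational as ℚ
open import Data.Rational.Properties using (_≟_)
import Data.Integer as ℤ
open import Relation.Nullary using (yes; no)

nat : ℕ → ℚ
nat k = (ℤ.+ k) ℚ./ 1

poch : ℚ → ℕ → ℚ
poch a zero    = 1ℚ
poch a (suc n) = poch a n * (a + nat n)

-- Total division: p / q, returning 0 when q = 0.
-- (Only used where the denominator is nonzero.)
div : ℚ → ℚ → ℚ
div p q with q ≟ 0ℚ
... | yes _  = 0ℚ
... | no q≢0 = _÷_ p q {{≢-nonZero q≢0}}

pow : ℚ → ℕ → ℚ
pow z zero = 1ℚ
pow z (suc n) = pow z n * z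

fact : ℕ → ℚ
fact n = poch 1ℚ n

term4F3 : ℚ → ℚ → ℚ → ℚ → ℚ → ℚ → ℚ → ℚ → ℕ → ℚ
term4F3 a1 a2 a3 a4 b1 b2 b3 z n =
  div (poch a1 n * poch a2 n * poch a3 n * poch a4 n * pow z n)
      (poch b1 n * poch b2 n * poch b3 n * fact n)

sumUpTo : (ℕ → ℚ) → ℕ → ℚ
sumUpTo f zero    = f zero
sumUpTo f (suc N) = sumUpTo f N + f (suc N)

-- The terminating series
-- 4F3[-i, i+1, -j, j+1; 1, D+2, -D; 1] = Σ_{n=0}^{min(i,j)} term_n
-- (terms with n > min(i,j) vanish because (-i)_n (-j)_n = 0).
F : ℕ → ℕ → ℕ → ℚ
F D i j = sumUpTo
  (term4F3 (- nat i) (nat (suc i)) (- nat j) (nat (suc j))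
           1ℚ (nat (suc (suc D))) (- nat D) 1ℚ)
  (ℕ._⊓_ i j)

{-# OPTIONS --safe #-}
-- F D i j is an eigenvalue of a stochastic matrix.  In representation-theoretic terms, let V be the
-- (D+1)-dimensional irreducible representation of sl₂ and T_q the components of a spherical tensor
-- operator of rank i on V; the squared entries of the T_q, suitably normalised, form a doubly
-- stochastic matrix commuting with the tridiagonal operator
--   (L t)(m) = p(m+1) (t(m) − t(m+1)) + p(m) (t(m) − t(m−1)),   p(m) = m (D+1−m),
-- whose eigenvectors are the discrete Chebyshev polynomials t_j, with distinct eigenvalues j (j+1).
-- Commutation is a discrete wave equation for the squared entries and follows from the two
-- first-order ladder relations for the entries.  Hence t_j is an eigenvector of the stochastic matrix;
-- evaluating at m = 0, where the entries are products, a Vandermonde sum identifies the eigenvalue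
-- as F D i j, and the maximum principle bounds it by 1.
module Submission where

open import Defs
open import Data.Nat using (ℕ; _≤_; zero; suc; pred; _∸_; _⊓_; _<_; z≤n; s≤s)
import Data.Nat as ℕ
import Data.Nat.Properties as ℕ
import Data.Nat.Coprimality as Coprime
open import Data.Rational
  using (ℚ; ∣_∣; 0ℚ; 1ℚ; _+_; _*_; _-_; -_; 1/_; positive; nonNegative; ≢-nonZero)
import Data.Rational as ℚ
import Data.Rational.Properties as ℚ
import Data.Integer as ℤ
import Data.Integer.Properties as ℤ
open import Data.List using ([]; _∷_)
open import Data.Product using (_×_; _,_; ∃; proj₂)
open import Data.Sum using (_⊎_; inj₁; inj₂)
open import Function using (_∘_)
open import Level using (0ℓ)
open import Relation.Nullary using (yes; no; contradiction)
open import Relation.Nullary.Decidable using (dec⇒maybe)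
open import Relation.Binary.PropositionalEquality
open import Tactic.RingSolver using (solve; solve-∀)
open import Tactic.RingSolver.Core.AlmostCommutativeRing
  using (AlmostCommutativeRing; fromCommutativeRing)

-- Rational arithmetic, order and total division.

ring : AlmostCommutativeRing 0ℓ 0ℓ
ring = fromCommutativeRing ℚ.+-*-commutativeRing (λ x → dec⇒maybe (0ℚ ℚ.≟ x))

infixr 7 _⊛_
infixr 6 _⊕_

_⊛_ : ∀ c {a b : ℚ} → a ≡ b → c * a ≡ c * b
c ⊛ eq = cong (c *_) eq

_⊕_ : ∀ {a b c d : ℚ} → a ≡ b → c ≡ d → a + c ≡ b + d
_⊕_ = cong₂ _+_

-- Reduces a goal to a polynomial identity: `a ≡ b` is a combination of hypotheses built with `⊛`
-- and `⊕`, and the ring solver checks that it has the same difference of sides as the goal.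
linear-combination : ∀ {x y a b : ℚ} → a ≡ b → x - y ≡ a - b → x ≡ y
linear-combination {x} {y} {a} refl eq = begin
  x             ≡⟨ split x y ⟩
  (x - y) + y   ≡⟨ cong (_+ y) eq ⟩
  (a - a) + y   ≡⟨ drop a y ⟩
  y             ∎
  where
  open ≡-Reasoning
  split : ∀ x y → x ≡ (x - y) + y
  split = solve-∀ ring
  drop : ∀ a y → (a - a) + y ≡ y
  drop = solve-∀ ring

nat-suc : ∀ n → nat (suc n) ≡ nat n + 1ℚ
nat-suc n = begin
  nat (suc n)                             ≡⟨ cong (ℚ._/ 1) step ⟩
  (ℤ.+ n ℤ.* ℤ.+ 1 ℤ.+ ℤ.+ 1 ℤ.* ℤ.+ 1) ℚ./ 1     ≡⟨⟩
  -- For a variable `n` the gcd normalisation inside `nat n` is stuck. Naming the reduced fraction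
  -- n/1 (the `0` is its denominator minus one) lets the addition unfold.
  ℚ.mkℚ (ℤ.+ n) 0 n⊥1 + 1ℚ                  ≡⟨ cong (_+ 1ℚ) (ℚ.normalize-coprime n⊥1) ⟨
  nat n + 1ℚ                              ∎
  where
  open ≡-Reasoning
  n⊥1 = Coprime.sym (Coprime.1-coprimeTo n)
  step : ℤ.+ suc n ≡ ℤ.+ n ℤ.* ℤ.+ 1 ℤ.+ ℤ.+ 1 ℤ.* ℤ.+ 1
  step = trans (cong ℤ.+_ (ℕ.+-comm 1 n)) (cong (ℤ._+ ℤ.+ 1) (sym (ℤ.*-identityʳ (ℤ.+ n))))

nat-+ : ∀ m n → nat (m ℕ.+ n) ≡ nat m + nat n
nat-+ zero    n = sym (ℚ.+-identityˡ (nat n))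
nat-+ (suc m) n = begin
  nat (suc (m ℕ.+ n))    ≡⟨ nat-suc (m ℕ.+ n) ⟩
  nat (m ℕ.+ n) + 1ℚ     ≡⟨ cong (_+ 1ℚ) (nat-+ m n) ⟩
  nat m + nat n + 1ℚ     ≡⟨ swap (nat m) (nat n) ⟩
  nat m + 1ℚ + nat n     ≡⟨ cong (_+ nat n) (nat-suc m) ⟨
  nat (suc m) + nat n    ∎
  where
  open ≡-Reasoning
  swap : ∀ x y → x + y + 1ℚ ≡ x + 1ℚ + y
  swap = solve-∀ ring

nat-∸ : ∀ {k n} → k ≤ n → nat (n ∸ k) ≡ nat n - nat k
nat-∸ {k} {n} k≤n = begin
  nat (n ∸ k)                      ≡⟨ drop (nat (n ∸ k)) (nat k) ⟨
  nat (n ∸ k) + nat k - nat k      ≡⟨ cong (_- nat k) (nat-+ (n ∸ k) k) ⟨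
  nat (n ∸ k ℕ.+ k) - nat k        ≡⟨ cong (λ l → nat l - nat k) (ℕ.m∸n+n≡m k≤n) ⟩
  nat n - nat k                    ∎
  where
  open ≡-Reasoning
  drop : ∀ x y → x + y - y ≡ x
  drop = solve-∀ ring

0≤nat : ∀ n → 0ℚ ℚ.≤ nat n
0≤nat n = ℚ.nonNegative⁻¹ (nat n) {{ℚ.normalize-nonNeg n 1}}

0<nat-suc : ∀ n → 0ℚ ℚ.< nat (suc n)
0<nat-suc n = ℚ.positive⁻¹ (nat (suc n)) {{ℚ.normalize-pos (suc n) 1}}

>⇒≢ : ∀ {x} → 0ℚ ℚ.< x → x ≢ 0ℚ
>⇒≢ 0<x x≡0 = ℚ.<⇒≢ 0<x (sym x≡0)

0≤*0≤ : ∀ {x y} → 0ℚ ℚ.≤ x → 0ℚ ℚ.≤ y → 0ℚ ℚ.≤ x * y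
0≤*0≤ {x} {y} 0≤x 0≤y = ℚ.nonNegative⁻¹ (x * y)
  {{ℚ.nonNeg*nonNeg⇒nonNeg x {{nonNegative 0≤x}} y {{nonNegative 0≤y}}}}

0<*0< : ∀ {x y} → 0ℚ ℚ.< x → 0ℚ ℚ.< y → 0ℚ ℚ.< x * y
0<*0< {x} {y} 0<x 0<y = ℚ.positive⁻¹ (x * y)
  {{ℚ.pos*pos⇒pos x {{positive 0<x}} y {{positive 0<y}}}}

0≤square : ∀ x → 0ℚ ℚ.≤ x * x
0≤square x with ℚ.≤-total 0ℚ x
... | inj₁ 0≤x = 0≤*0≤ 0≤x 0≤x
... | inj₂ x≤0 = subst (0ℚ ℚ.≤_) (neg² x) (0≤*0≤ 0≤-x 0≤-x)
  where
  0≤-x : 0ℚ ℚ.≤ - x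
  0≤-x = ℚ.neg-antimono-≤ x≤0
  neg² : ∀ x → (- x) * (- x) ≡ x * x
  neg² = solve-∀ ring

div-* : ∀ x {y} → y ≢ 0ℚ → div x y * y ≡ x
div-* x {y} y≢0 with y ℚ.≟ 0ℚ
... | yes y≡0 = contradiction y≡0 y≢0
... | no  y≢0′ = begin
  x * (1/ y) * y    ≡⟨ ℚ.*-assoc x (1/ y) y ⟩
  x * ((1/ y) * y)  ≡⟨ cong (x *_) (ℚ.*-inverseˡ y) ⟩
  x * 1ℚ            ≡⟨ ℚ.*-identityʳ x ⟩
  x                 ∎
  where
  open ≡-Reasoning
  instance _ = ≢-nonZero y≢0′

div-zeroˡ : ∀ y → div 0ℚ y ≡ 0ℚ
div-zeroˡ y with y ℚ.≟ 0ℚ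
... | yes _   = refl
... | no  y≢0 = ℚ.*-zeroˡ (1/ y)
  where instance _ = ≢-nonZero y≢0

*-cancelʳ : ∀ {x y z} → z ≢ 0ℚ → x * z ≡ y * z → x ≡ y
*-cancelʳ {x} {y} {z} z≢0 eq = trans (expand x) (trans (cong (_* 1/ z) eq) (sym (expand y)))
  where
  instance _ = ≢-nonZero z≢0
  expand : ∀ u → u ≡ u * z * (1/ z)
  expand u = trans (sym (ℚ.*-identityʳ u))
    (trans (cong (u *_) (sym (ℚ.*-inverseʳ z))) (sym (ℚ.*-assoc u z (1/ z))))

*-≢0 : ∀ {x y} → x ≢ 0ℚ → y ≢ 0ℚ → x * y ≢ 0ℚ
*-≢0 {x} {y} x≢0 y≢0 xy≡0 = x≢0 (*-cancelʳ y≢0 (trans xy≡0 (sym (ℚ.*-zeroˡ y))))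

0*≡0* : ∀ {x u v} → x ≡ 0ℚ → x * u ≡ x * v
0*≡0* {u = u} {v} refl = trans (ℚ.*-zeroˡ u) (sym (ℚ.*-zeroˡ v))

0≤div : ∀ {x y} → 0ℚ ℚ.≤ x → 0ℚ ℚ.< y → 0ℚ ℚ.≤ div x y
0≤div {x} {y} 0≤x 0<y = ℚ.*-cancelʳ-≤-pos y {{positive 0<y}}
  (subst₂ ℚ._≤_ (sym (ℚ.*-zeroˡ y)) (sym (div-* x (>⇒≢ 0<y))) 0≤x)

0<div : ∀ {x y} → 0ℚ ℚ.< x → 0ℚ ℚ.< y → 0ℚ ℚ.< div x y
0<div {x} {y} 0<x 0<y = ℚ.*-cancelʳ-<-nonNeg y {{ℚ.pos⇒nonNeg y {{positive 0<y}}}}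
  (subst₂ ℚ._<_ (sym (ℚ.*-zeroˡ y)) (sym (div-* x (>⇒≢ 0<y))) 0<x)

-- Finite sums and maxima.

sum-cong : ∀ {f g} N → (∀ n → n ≤ N → f n ≡ g n) → sumUpTo f N ≡ sumUpTo g N
sum-cong zero    eq = eq 0 z≤n
sum-cong (suc N) eq =
  cong₂ _+_ (sum-cong N (λ n n≤N → eq n (ℕ.m≤n⇒m≤1+n n≤N))) (eq (suc N) ℕ.≤-refl)

sum-+ : ∀ f g N → sumUpTo (λ n → f n + g n) N ≡ sumUpTo f N + sumUpTo g N
sum-+ f g zero    = refl
sum-+ f g (suc N) = trans (cong (_+ (f (suc N) + g (suc N))) (sum-+ f g N))
  (interchange (sumUpTo f N) (sumUpTo g N) (f (suc N)) (g (suc N)))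
  where
  interchange : ∀ a b c d → (a + b) + (c + d) ≡ (a + c) + (b + d)
  interchange = solve-∀ ring

sum-*ˡ : ∀ c f N → sumUpTo (λ n → c * f n) N ≡ c * sumUpTo f N
sum-*ˡ c f zero    = refl
sum-*ˡ c f (suc N) = trans (cong (_+ c * f (suc N)) (sum-*ˡ c f N))
  (sym (ℚ.*-distribˡ-+ c (sumUpTo f N) (f (suc N))))

sum-swap : ∀ (f : ℕ → ℕ → ℚ) M N →
  sumUpTo (λ m → sumUpTo (f m) N) M ≡ sumUpTo (λ n → sumUpTo (λ m → f m n) M) N
sum-swap f zero    N = refl
sum-swap f (suc M) N = trans (cong (_+ sumUpTo (f (suc M)) N) (sum-swap f M N))
  (sym (sum-+ (λ n → sumUpTo (λ m → f m n) M) (f (suc M)) N))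

sum-telescope : ∀ {f} (g : ℕ → ℚ) N → (∀ n → n ≤ N → f n ≡ g (suc n) - g n) → sumUpTo f N ≡ g (suc N) - g 0
sum-telescope g zero    eq = eq 0 z≤n
sum-telescope g (suc N) eq = trans
  (cong₂ _+_ (sum-telescope g N (λ n n≤N → eq n (ℕ.m≤n⇒m≤1+n n≤N))) (eq (suc N) ℕ.≤-refl))
  (chain (g (suc N)) (g 0) (g (suc (suc N))))
  where
  chain : ∀ a b c → (a - b) + (c - a) ≡ c - b
  chain = solve-∀ ring

-- Lets the cut-off `i ⊓ j` of `F` be raised to `j`, the range over which the Chebyshev polynomial
-- is expanded.
sum-⊓ : ∀ f i j → (∀ n → i < n → f n ≡ 0ℚ) → sumUpTo f (i ⊓ j) ≡ sumUpTo f j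
sum-⊓ f i zero    zeros = cong (sumUpTo f) (ℕ.⊓-zeroʳ i)
sum-⊓ f i (suc j) zeros with ℕ.<-≤-connex i (suc j)
... | inj₂ 1+j≤i = cong (sumUpTo f) (ℕ.m≥n⇒m⊓n≡n 1+j≤i)
... | inj₁ i<1+j = begin
  sumUpTo f (i ⊓ suc j)      ≡⟨ cong (sumUpTo f) (ℕ.m≤n⇒m⊓n≡m (ℕ.<⇒≤ i<1+j)) ⟩
  sumUpTo f i                ≡⟨ cong (sumUpTo f) (ℕ.m≤n⇒m⊓n≡m (ℕ.≤-pred i<1+j)) ⟨
  sumUpTo f (i ⊓ j)          ≡⟨ sum-⊓ f i j zeros ⟩
  sumUpTo f j                ≡⟨ ℚ.+-identityʳ _ ⟨
  sumUpTo f j + 0ℚ           ≡⟨ cong (sumUpTo f j +_) (zeros (suc j) i<1+j) ⟨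
  sumUpTo f j + f (suc j)    ∎
  where open ≡-Reasoning

sum-mono : ∀ {f g} N → (∀ n → n ≤ N → f n ℚ.≤ g n) → sumUpTo f N ℚ.≤ sumUpTo g N
sum-mono zero    le = le 0 z≤n
sum-mono (suc N) le =
  ℚ.+-mono-≤ (sum-mono N (λ n n≤N → le n (ℕ.m≤n⇒m≤1+n n≤N))) (le (suc N) ℕ.≤-refl)

∣sum∣≤sum∣∣ : ∀ f N → ∣ sumUpTo f N ∣ ℚ.≤ sumUpTo (∣_∣ ∘ f) N
∣sum∣≤sum∣∣ f zero    = ℚ.≤-refl
∣sum∣≤sum∣∣ f (suc N) = ℚ.≤-trans (ℚ.∣p+q∣≤∣p∣+∣q∣ (sumUpTo f N) (f (suc N)))
  (ℚ.+-monoˡ-≤ ∣ f (suc N) ∣ (∣sum∣≤sum∣∣ f N))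

head≤sum : ∀ f N → (∀ n → n ≤ N → 0ℚ ℚ.≤ f n) → f 0 ℚ.≤ sumUpTo f N
head≤sum f zero    0≤f = ℚ.≤-refl
head≤sum f (suc N) 0≤f = subst (ℚ._≤ sumUpTo f (suc N)) (ℚ.+-identityʳ (f 0))
  (ℚ.+-mono-≤ (head≤sum f N (λ n n≤N → 0≤f n (ℕ.m≤n⇒m≤1+n n≤N))) (0≤f (suc N) ℕ.≤-refl))

argmax : ∀ (f : ℕ → ℚ) N → ∃ λ k → k ≤ N × (∀ n → n ≤ N → f n ℚ.≤ f k)
argmax f zero = 0 , z≤n , λ { .0 z≤n → ℚ.≤-refl }
argmax f (suc N) with argmax f N
... | k , k≤N , max with ℚ.≤-total (f k) (f (suc N))
...   | inj₁ fk≤ = suc N , ℕ.≤-refl , λ n n≤ → case (ℕ.m≤n⇒m<n∨m≡n n≤)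
  where
  case : ∀ {n} → n < suc N ⊎ n ≡ suc N → f n ℚ.≤ f (suc N)
  case (inj₁ (s≤s n≤N)) = ℚ.≤-trans (max _ n≤N) fk≤
  case (inj₂ refl)      = ℚ.≤-refl
...   | inj₂ ≤fk = k , ℕ.m≤n⇒m≤1+n k≤N , λ n n≤ → case (ℕ.m≤n⇒m<n∨m≡n n≤)
  where
  case : ∀ {n} → n < suc N ⊎ n ≡ suc N → f n ℚ.≤ f k
  case (inj₁ (s≤s n≤N)) = max _ n≤N
  case (inj₂ refl)      = ≤fk

sum-linear₂ : ∀ a b f g N →
  sumUpTo (λ n → a * f n + b * g n) N ≡ a * sumUpTo f N + b * sumUpTo g N
sum-linear₂ a b f g N = trans (sum-+ _ _ N) (cong₂ _+_ (sum-*ˡ a f N) (sum-*ˡ b g N))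

sum-linear₃ : ∀ a b c f g h N →
  sumUpTo (λ n → a * f n + b * g n + c * h n) N ≡ a * sumUpTo f N + b * sumUpTo g N + c * sumUpTo h N
sum-linear₃ a b c f g h N = trans (sum-+ _ _ N) (cong₂ _+_ (sum-linear₂ a b f g N) (sum-*ˡ c h N))

-- Rising factorials.

-- Two factorisations of (x)ₙ₊₁, splitting off the last or the first factor. With x = -(m+1) this
-- moves the grid variable by one.
poch-shift : ∀ x n → poch x n * (x + nat n) ≡ x * poch (x + 1ℚ) n
poch-shift x zero    = start x
  where
  start : ∀ x → 1ℚ * (x + 0ℚ) ≡ x * 1ℚ
  start = solve-∀ ring
poch-shift x (suc n) = step x (nat n) (nat (suc n)) (poch x n) (poch (x + 1ℚ) n) (nat-suc n) (poch-shift x n)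
  where
  step : ∀ x n n′ a b → n′ ≡ n + 1ℚ → a * (x + n) ≡ x * b → a * (x + n) * (x + n′) ≡ x * (b * (x + 1ℚ + n))
  step x n .(n + 1ℚ) a b refl eq = linear-combination ((x + n + 1ℚ) ⊛ eq) (solve (x ∷ n ∷ a ∷ b ∷ []) ring)

poch-shift-neg : ∀ m k → poch (- nat (suc m)) k * (- nat (suc m) + nat k) ≡ - nat (suc m) * poch (- nat m) k
poch-shift-neg m k = trans (poch-shift (- nat (suc m)) k)
  (cong (λ x → - nat (suc m) * poch x k) (step (nat m) (nat (suc m)) (nat-suc m)))
  where
  step : ∀ m m′ → m′ ≡ m + 1ℚ → - m′ + 1ℚ ≡ - m
  step m .(m + 1ℚ) refl = solve (m ∷ []) ring

poch-zero : ∀ k → poch (- nat 0) (suc k) ≡ 0ℚ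
poch-zero k = trans (poch-shift 0ℚ k) (ℚ.*-zeroˡ (poch 1ℚ k))

poch-vanish : ∀ {i k} → i < k → poch (- nat i) k ≡ 0ℚ
poch-vanish {i} {suc k} i<1+k with ℕ.m≤n⇒m<n∨m≡n (ℕ.≤-pred i<1+k)
... | inj₁ i<k  = trans (cong (_* (- nat i + nat k)) (poch-vanish i<k)) (ℚ.*-zeroˡ (- nat i + nat k))
... | inj₂ refl = trans (cong (poch (- nat i) i *_) (ℚ.+-inverseˡ (nat i))) (ℚ.*-zeroʳ (poch (- nat i) i))

0<poch : ∀ {x} → 0ℚ ℚ.< x → ∀ k → 0ℚ ℚ.< poch x k
0<poch 0<x zero    = ℚ.positive⁻¹ 1ℚ
0<poch 0<x (suc k) = 0<*0< (0<poch 0<x k) (ℚ.+-mono-<-≤ 0<x (0≤nat k))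

pow-1 : ∀ k → pow 1ℚ k ≡ 1ℚ
pow-1 zero    = refl
pow-1 (suc k) = cong (_* 1ℚ) (pow-1 k)

-- Weights of the tridiagonal operator.

module Grid (D : ℕ) where

  p : ℕ → ℚ
  p m = nat m * (nat D + 1ℚ - nat m)

  p0≡0 : p 0 ≡ 0ℚ
  p0≡0 = ℚ.*-zeroˡ (nat D + 1ℚ - nat 0)

  p[1+D]≡0 : p (suc D) ≡ 0ℚ
  p[1+D]≡0 = annihilate (nat (suc D)) (nat D) (nat-suc D)
    where
    annihilate : ∀ s d → s ≡ d + 1ℚ → s * (d + 1ℚ - s) ≡ 0ℚ
    annihilate .(d + 1ℚ) d refl = solve (d ∷ []) ring

  p-suc : ∀ m → p (suc m) ≡ (nat m + 1ℚ) * (nat D - nat m)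
  p-suc m = step (nat D) (nat m) (nat (suc m)) (nat-suc m)
    where
    step : ∀ d m m′ → m′ ≡ m + 1ℚ → m′ * (d + 1ℚ - m′) ≡ (m + 1ℚ) * (d - m)
    step d m .(m + 1ℚ) refl = solve (d ∷ m ∷ []) ring

  0<D-m : ∀ {m} → m < D → 0ℚ ℚ.< nat D - nat m
  0<D-m {m} m<D = subst (0ℚ ℚ.<_) (trans (cong nat (ℕ.suc-pred (D ∸ m))) (nat-∸ (ℕ.<⇒≤ m<D)))
    (0<nat-suc (pred (D ∸ m)))
    where instance _ = ℕ.>-nonZero (ℕ.m<n⇒0<n∸m m<D)

  m-D≢0 : ∀ {m} → m < D → nat m - nat D ≢ 0ℚ
  m-D≢0 {m} m<D eq = >⇒≢ (0<D-m m<D) (trans (flip (nat m) (nat D)) (cong -_ eq))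
    where
    flip : ∀ m d → d - m ≡ - (m - d)
    flip = solve-∀ ring

  0<p-suc : ∀ {m} → m < D → 0ℚ ℚ.< p (suc m)
  0<p-suc {m} m<D = subst (0ℚ ℚ.<_) (sym (p-suc m))
    (0<*0< (subst (0ℚ ℚ.<_) (nat-suc m) (0<nat-suc m)) (0<D-m m<D))

  P : ℕ → ℚ
  P zero    = 1ℚ
  P (suc m) = P m * p (suc m)

  0<P : ∀ {m} → m ≤ D → 0ℚ ℚ.< P m
  0<P {zero}  _   = ℚ.positive⁻¹ 1ℚ
  0<P {suc m} m<D = 0<*0< (0<P (ℕ.<⇒≤ m<D)) (0<p-suc m<D)

  -- The reciprocal of `P m` for `m ≤ D`. Past `D` it is 0, since `p (suc D)` is 0 and `div` then
  -- returns 0.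
  r : ℕ → ℚ
  r zero    = 1ℚ
  r (suc m) = div (r m) (p (suc m))

  0<r : ∀ {m} → m ≤ D → 0ℚ ℚ.< r m
  0<r {zero}  _   = ℚ.positive⁻¹ 1ℚ
  0<r {suc m} m<D = 0<div (0<r (ℕ.<⇒≤ m<D)) (0<p-suc m<D)

  r-suc : ∀ {m} → m < D → r (suc m) * p (suc m) ≡ r m
  r-suc {m} m<D = div-* (r m) (>⇒≢ (0<p-suc m<D))

  poch-D≢0 : ∀ {k} → k ≤ D → poch (- nat D) k ≢ 0ℚ
  poch-D≢0 {suc k} k<D = *-≢0 (poch-D≢0 (ℕ.<⇒≤ k<D))
    (m-D≢0 k<D ∘ trans (ℚ.+-comm (nat k) (- nat D)))

-- Discrete Chebyshev polynomials.

module Chebyshev (D j : ℕ) where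

  open Grid D

  Λ : ℚ
  Λ = nat j * (nat j + 1ℚ)

  c : ℕ → ℚ
  c zero    = 1ℚ
  c (suc k) = div (c k * ((nat k - nat j) * (nat k + nat j + 1ℚ)))
                  ((nat k + 1ℚ) * (nat k + 1ℚ) * (nat k - nat D))

  c-suc : ∀ {k} → k < D →
    c (suc k) * ((nat k + 1ℚ) * (nat k + 1ℚ) * (nat k - nat D)) ≡ c k * ((nat k - nat j) * (nat k + nat j + 1ℚ))
  c-suc {k} k<D = div-* _ (*-≢0 (*-≢0 k+1≢0 k+1≢0) (m-D≢0 k<D))
    where
    k+1≢0 : nat k + 1ℚ ≢ 0ℚ
    k+1≢0 = >⇒≢ (subst (0ℚ ℚ.<_) (nat-suc k) (0<nat-suc k))

  c-closed : ∀ {k} → k ≤ D →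
    c k * (poch 1ℚ k * poch (- nat D) k * fact k) ≡ poch (- nat j) k * poch (nat (suc j)) k
  c-closed {zero}  _   = refl
  c-closed {suc k} k<D = step (nat k) (nat j) (nat (suc j)) (nat D) (c k) (c (suc k))
    (poch 1ℚ k) (poch (- nat D) k) (poch (- nat j) k) (poch (nat (suc j)) k)
    (nat-suc j) (c-suc k<D) (c-closed (ℕ.<⇒≤ k<D))
    where
    step : ∀ k j j′ d c c′ f g u v → j′ ≡ j + 1ℚ →
      c′ * ((k + 1ℚ) * (k + 1ℚ) * (k - d)) ≡ c * ((k - j) * (k + j + 1ℚ)) →
      c * (f * g * f) ≡ u * v →
      c′ * (f * (1ℚ + k) * (g * (- d + k)) * (f * (1ℚ + k))) ≡ u * (- j + k) * (v * (j′ + k))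
    step k j .(j + 1ℚ) d c c′ f g u v refl rec closed = linear-combination
      ((f * g * f) ⊛ rec ⊕ ((k - j) * (k + j + 1ℚ)) ⊛ closed)
      (solve (k ∷ j ∷ d ∷ c ∷ c′ ∷ f ∷ g ∷ u ∷ v ∷ []) ring)

  -- For `j ≤ D` this is ₃F₂[-j, j+1, -m; 1, -D; 1], normalised to 1 at `m = 0`; the factor (-j)ₖ
  -- ends the series at `k = j`.
  t : ℕ → ℚ
  t m = sumUpTo (λ k → c k * poch (- nat m) k) j

  t0≡1 : t 0 ≡ 1ℚ
  t0≡1 = trans (sym (sum-⊓ (λ k → c k * poch (- nat 0) k) 0 j zeros)) (ℚ.*-identityʳ 1ℚ)
    where
    zeros : ∀ k → 0 < k → c k * poch (- nat 0) k ≡ 0ℚ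
    zeros (suc k) _ = trans (cong (c (suc k) *_) (poch-zero k)) (ℚ.*-zeroʳ (c (suc k)))

  -- The factor m of `p m` completes the shifted symbol: m times (-(m-1))ₖ₊₁ is -(-m)ₖ₊₂. At `m = 0`
  -- both sides vanish.
  p-poch-pred : ∀ m k → p m * poch (- nat (pred m)) (suc k)
    ≡ - (nat D + 1ℚ - nat m) * (poch (- nat m) k * (- nat m + nat k)) * (nat k + 1ℚ - nat m)
  p-poch-pred zero k = trans (trans (cong (_* poch (- nat 0) (suc k)) p0≡0) (ℚ.*-zeroˡ (poch (- nat 0) (suc k))))
    (sym (trans (cong (λ x → - (nat D + 1ℚ - 0ℚ) * x * (nat k + 1ℚ - 0ℚ)) (poch-zero k))
      (annihilate (nat D) (nat k))))
    where
    annihilate : ∀ d k → - (d + 1ℚ - 0ℚ) * 0ℚ * (k + 1ℚ - 0ℚ) ≡ 0ℚ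
    annihilate = solve-∀ ring
  p-poch-pred (suc m) k = step (nat D) (nat m) (nat (suc m)) (nat k)
    (poch (- nat m) k) (poch (- nat (suc m)) k) (nat-suc m) (poch-shift-neg m k)
    where
    step : ∀ d m m′ k f f⁺ → m′ ≡ m + 1ℚ → f⁺ * (- m′ + k) ≡ - m′ * f →
      m′ * (d + 1ℚ - m′) * (f * (- m + k)) ≡ - (d + 1ℚ - m′) * (f⁺ * (- m′ + k)) * (k + 1ℚ - m′)
    step d m .(m + 1ℚ) k f f⁺ refl eq = linear-combination
      (((d - m) * (k - m)) ⊛ eq) (solve (d ∷ m ∷ k ∷ f ∷ f⁺ ∷ []) ring)

  -- The operator sends (-m)ₖ to k(k+1)(-m)ₖ plus a multiple of (-m)ₖ₋₁; the recursion of `c` makes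
  -- these lower terms cancel against the previous summand.
  t-eigen : j ≤ D → ∀ m → (Λ - p (suc m) - p m) * t m + p (suc m) * t (suc m) + p m * t (pred m) ≡ 0ℚ
  t-eigen j≤D m = begin
    α * t m + p (suc m) * t (suc m) + p m * t (pred m)
      ≡⟨ sum-linear₃ α (p (suc m)) (p m) (f m) (f (suc m)) (f (pred m)) j ⟨
    sumUpTo (λ k → α * f m k + p (suc m) * f (suc m) k + p m * f (pred m) k) j
      ≡⟨ sum-telescope H j telescopes ⟩
    H (suc j) - H 0
      ≡⟨ vanish (nat j) (c j) (poch (- nat m) j) ⟩
    0ℚ ∎
    where
    open ≡-Reasoning
    α = Λ - p (suc m) - p m
    f : ℕ → ℕ → ℚ
    f m k = c k * poch (- nat m) k
    -- `H (suc k)` is what remains after summing through `k`; at `k = j` its factor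
    -- `Λ - nat k * (nat k + 1ℚ)` is zero.
    H : ℕ → ℚ
    H zero    = 0ℚ
    H (suc k) = (Λ - nat k * (nat k + 1ℚ)) * (c k * poch (- nat m) k)
    vanish : ∀ j c φ → (j * (j + 1ℚ) - j * (j + 1ℚ)) * (c * φ) - 0ℚ ≡ 0ℚ
    vanish = solve-∀ ring
    start : ∀ l p p′ → (l - p′ - p) * (1ℚ * 1ℚ) + p′ * (1ℚ * 1ℚ) + p * (1ℚ * 1ℚ) ≡ (l - 0ℚ * (0ℚ + 1ℚ)) * (1ℚ * 1ℚ) - 0ℚ
    start = solve-∀ ring
    step : ∀ l d j m m′ k k′ c c′ φ φ⁺ φ⁻ p →
      l ≡ j * (j + 1ℚ) → m′ ≡ m + 1ℚ → k′ ≡ k + 1ℚ →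
      p ≡ m * (d + 1ℚ - m) →
      c′ * ((k + 1ℚ) * (k + 1ℚ) * (k - d)) ≡ c * ((k - j) * (k + j + 1ℚ)) →
      φ⁺ * (- m′ + k) ≡ - m′ * φ →
      p * φ⁻ ≡ - (d + 1ℚ - m) * (φ * (- m + k)) * (k + 1ℚ - m) →
      (l - m′ * (d + 1ℚ - m′) - p) * (c′ * (φ * (- m + k))) + m′ * (d + 1ℚ - m′) * (c′ * (φ⁺ * (- m′ + k))) + p * (c′ * φ⁻)
        ≡ (l - k′ * (k′ + 1ℚ)) * (c′ * (φ * (- m + k))) - (l - k * (k + 1ℚ)) * (c * φ)
    step .(j * (j + 1ℚ)) d j m .(m + 1ℚ) k .(k + 1ℚ) c c′ φ φ⁺ φ⁻ .(m * (d + 1ℚ - m)) refl refl refl refl rec shift shift⁻ =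
      linear-combination
        (φ ⊛ rec ⊕ ((m + 1ℚ) * (d - m) * c′) ⊛ shift ⊕ c′ ⊛ shift⁻)
        (solve (d ∷ j ∷ m ∷ k ∷ c ∷ c′ ∷ φ ∷ φ⁺ ∷ φ⁻ ∷ []) ring)
    telescopes : ∀ k → k ≤ j → α * f m k + p (suc m) * f (suc m) k + p m * f (pred m) k ≡ H (suc k) - H k
    telescopes zero    _   = start Λ (p m) (p (suc m))
    telescopes (suc k) k<j = step Λ (nat D) (nat j) (nat m) (nat (suc m)) (nat k) (nat (suc k)) (c k) (c (suc k))
      (poch (- nat m) k) (poch (- nat (suc m)) k) (poch (- nat (pred m)) (suc k)) (p m)
      refl (nat-suc m) (nat-suc k) refl (c-suc (ℕ.<-≤-trans k<j j≤D)) (poch-shift-neg m k) (p-poch-pred m k)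

-- Tensor components and their ladder relations.

module Kernel (D i : ℕ) where

  open Grid D

  private
    ι = nat i

  -- Y m n is, up to positive row and column factors and a factor depending on m − n, the (m, n) entry
  -- of the tensor component of weight m − n.  Its recursion is the lowering relation and Y-lower the
  -- raising one.  Where pred 0 occurs it is multiplied by p 0 = 0, here and below.
  Y : ℕ → ℕ → ℚ
  Y zero    zero    = 1ℚ
  Y zero    (suc n) = - (ι + nat n + 1ℚ) * Y zero n
  Y (suc m) n       = (ι + nat m + 1ℚ - nat n) * Y m n + p n * Y m (pred n)

  Y-pred : ∀ m n →
    p m * ((ι + nat m - nat n) * Y (pred m) n + p n * Y (pred m) (pred n)) ≡ p m * Y m n
  Y-pred zero n = 0*≡0* p0≡0
  Y-pred (suc m) n = cong (λ x → p (suc m) * (x * Y m n + p n * Y m (pred n)))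
    (shift ι (nat m) (nat n) (nat (suc m)) (nat-suc m))
    where
    shift : ∀ i m n s → s ≡ m + 1ℚ → i + s - n ≡ i + m + 1ℚ - n
    shift i m n .(m + 1ℚ) refl = solve (i ∷ m ∷ n ∷ []) ring

  Y-lower-pred : ∀ m → (∀ n → p m * Y (pred m) n - Y m (suc n) ≡ (ι - nat m + nat n + 1ℚ) * Y m n) →
    ∀ n → p n * (p m * Y (pred m) (pred n) - Y m n) ≡ p n * ((ι - nat m + nat n) * Y m (pred n))
  Y-lower-pred m lower zero = 0*≡0* p0≡0
  Y-lower-pred m lower (suc n) = cong (p (suc n) *_) (trans (lower n)
    (cong (_* Y m n) (shift ι (nat m) (nat n) (nat (suc n)) (nat-suc n))))
    where
    shift : ∀ i m n s → s ≡ n + 1ℚ → i - m + n + 1ℚ ≡ i - m + s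
    shift i m n .(n + 1ℚ) refl = solve (i ∷ m ∷ n ∷ []) ring

  -- Induction on `m`: the relation in row `m`, taken in column `n` and in the column before, is
  -- combined with the recursion that produced row `m`.
  Y-lower : ∀ m n → p m * Y (pred m) n - Y m (suc n) ≡ (ι - nat m + nat n + 1ℚ) * Y m n
  Y-lower zero n = first ι (nat n) (p 0) (Y 0 n) p0≡0
    where
    first : ∀ i n p₀ y → p₀ ≡ 0ℚ → p₀ * y - (- (i + n + 1ℚ)) * y ≡ (i - 0ℚ + n + 1ℚ) * y
    first i n .0ℚ y refl = solve (i ∷ n ∷ y ∷ []) ring
  Y-lower (suc m) n = next ι (nat D) (nat m) (nat n) (nat (suc m)) (nat (suc n))
    (Y m n) (Y (pred m) n) (Y m (suc n)) (Y m (pred n)) (Y (pred m) (pred n))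
    (nat-suc m) (nat-suc n) (Y-lower m n) (Y-pred m n) (Y-lower-pred m (Y-lower m) n)
    where
    next : ∀ i d m n m′ n′ y u b v w →
      let pᵐ  = m * (d + 1ℚ - m)
          pⁿ  = n * (d + 1ℚ - n)
          pᵐ′ = m′ * (d + 1ℚ - m′)
          pⁿ′ = n′ * (d + 1ℚ - n′)
      in m′ ≡ m + 1ℚ → n′ ≡ n + 1ℚ →
         pᵐ * u - b ≡ (i - m + n + 1ℚ) * y →
         pᵐ * ((i + m - n) * u + pⁿ * w) ≡ pᵐ * y →
         pⁿ * (pᵐ * w - y) ≡ pⁿ * ((i - m + n) * v) →
         pᵐ′ * y - ((i + m + 1ℚ - n′) * b + pⁿ′ * y)
           ≡ (i - m′ + n + 1ℚ) * ((i + m + 1ℚ - n) * y + pⁿ * v)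
    next i d m n .(m + 1ℚ) .(n + 1ℚ) y u b v w refl refl lower rec pred =
      linear-combination
        ((i + m - n) ⊛ lower ⊕ (- 1ℚ) ⊛ rec ⊕ pred)
        (solve (i ∷ d ∷ m ∷ n ∷ y ∷ u ∷ b ∷ v ∷ w ∷ []) ring)

  -- h d = binomial (2i, i+d) / binomial (2i, i) and κ m n = h ∣m−n∣ turn Y into its dual scaling κ Y,
  -- for which the two factors i ± (m−n) of the ladder relations are exchanged.
  h : ℕ → ℚ
  h zero    = 1ℚ
  h (suc d) = div (h d * nat (i ∸ d)) (ι + nat d + 1ℚ)

  private
    0<ι+n+1 : ∀ n → 0ℚ ℚ.< ι + nat n + 1ℚ
    0<ι+n+1 n = subst (0ℚ ℚ.<_)
      (trans (nat-suc (i ℕ.+ n)) (cong (_+ 1ℚ) (nat-+ i n))) (0<nat-suc (i ℕ.+ n))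

  0≤h : ∀ d → 0ℚ ℚ.≤ h d
  0≤h zero    = ℚ.nonNegative⁻¹ 1ℚ
  0≤h (suc d) = 0≤div (0≤*0≤ (0≤h d) (0≤nat (i ∸ d))) (0<ι+n+1 d)

  h-suc-* : ∀ d → h (suc d) * (ι + nat d + 1ℚ) ≡ h d * nat (i ∸ d)
  h-suc-* d = div-* (h d * nat (i ∸ d)) (>⇒≢ (0<ι+n+1 d))

  h-vanish : ∀ {d} → i < d → h d ≡ 0ℚ
  h-vanish {suc d} (s≤s i≤d) = *-cancelʳ (>⇒≢ (0<ι+n+1 d)) (begin
    h (suc d) * (ι + nat d + 1ℚ)  ≡⟨ h-suc-* d ⟩
    h d * nat (i ∸ d)             ≡⟨ cong (λ k → h d * nat k) (ℕ.m≤n⇒m∸n≡0 i≤d) ⟩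
    h d * 0ℚ                      ≡⟨ ℚ.*-zeroʳ (h d) ⟩
    0ℚ                            ≡⟨ ℚ.*-zeroˡ (ι + nat d + 1ℚ) ⟨
    0ℚ * (ι + nat d + 1ℚ)         ∎)
    where open ≡-Reasoning

  -- The truncated `i ∸ d` in `h` makes nonnegativity immediate; this recovers the polynomial
  -- factor. Past `i`, where the two differ, both sides are zero.
  h-suc : ∀ d → h (suc d) * (ι + nat d + 1ℚ) ≡ h d * (ι - nat d)
  h-suc d with ℕ.≤-<-connex d i
  ... | inj₁ d≤i = trans (h-suc-* d) (cong (h d *_) (nat-∸ d≤i))
  ... | inj₂ i<d = trans (0*≡ (h-vanish (ℕ.m≤n⇒m≤1+n i<d))) (sym (0*≡ (h-vanish i<d)))
    where
    0*≡ : ∀ {x u} → x ≡ 0ℚ → x * u ≡ 0ℚ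
    0*≡ {u = u} refl = ℚ.*-zeroˡ u

  κ : ℕ → ℕ → ℚ
  κ zero    n       = h n
  κ (suc m) zero    = h (suc m)
  κ (suc m) (suc n) = κ m n

  κ-zeroʳ : ∀ m → κ m 0 ≡ h m
  κ-zeroʳ zero    = refl
  κ-zeroʳ (suc m) = refl

  0≤κ : ∀ m n → 0ℚ ℚ.≤ κ m n
  0≤κ zero    n       = 0≤h n
  0≤κ (suc m) zero    = 0≤h (suc m)
  0≤κ (suc m) (suc n) = 0≤κ m n

  private
    shift⁺ : ∀ i m n m′ n′ → m′ ≡ m + 1ℚ → n′ ≡ n + 1ℚ → i + m′ - n′ ≡ i + m - n
    shift⁺ i m n .(m + 1ℚ) .(n + 1ℚ) refl refl = solve (i ∷ m ∷ n ∷ []) ring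

    shift⁻ : ∀ i m n m′ n′ → m′ ≡ m + 1ℚ → n′ ≡ n + 1ℚ → i - m′ + n′ ≡ i - m + n
    shift⁻ i m n .(m + 1ℚ) .(n + 1ℚ) refl refl = solve (i ∷ m ∷ n ∷ []) ring

  -- One formula serves both sides of the diagonal: for `n ≤ m` the distance grows and this is
  -- `h-suc`; for `m < n` it shrinks and this is `h-suc` read backwards.
  κ-sucˡ : ∀ m n → κ (suc m) n * (ι + nat m - nat n + 1ℚ) ≡ κ m n * (ι - nat m + nat n)
  κ-sucˡ m zero = reshape ι (nat m) (h (suc m)) (κ m 0)
    (trans (h-suc m) (cong (_* (ι - nat m)) (sym (κ-zeroʳ m))))
    where
    reshape : ∀ i m k′ k → k′ * (i + m + 1ℚ) ≡ k * (i - m) →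
      k′ * (i + m - 0ℚ + 1ℚ) ≡ k * (i - m + 0ℚ)
    reshape i m k′ k eq = linear-combination eq (solve (i ∷ m ∷ k′ ∷ k ∷ []) ring)
  κ-sucˡ zero (suc n) = reshape ι (nat n) (nat (suc n)) (h (suc n)) (h n) (nat-suc n) (h-suc n)
    where
    reshape : ∀ i n n′ k′ k → n′ ≡ n + 1ℚ → k′ * (i + n + 1ℚ) ≡ k * (i - n) →
      k * (i + 0ℚ - n′ + 1ℚ) ≡ k′ * (i - 0ℚ + n′)
    reshape i n .(n + 1ℚ) k′ k refl eq =
      linear-combination ((- 1ℚ) ⊛ eq) (solve (i ∷ n ∷ k′ ∷ k ∷ []) ring)
  κ-sucˡ (suc m) (suc n) = begin
    κ (suc m) n * (ι + nat (suc m) - nat (suc n) + 1ℚ)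
      ≡⟨ cong (λ x → κ (suc m) n * (x + 1ℚ)) (shift⁺ ι (nat m) (nat n) _ _ (nat-suc m) (nat-suc n)) ⟩
    κ (suc m) n * (ι + nat m - nat n + 1ℚ)
      ≡⟨ κ-sucˡ m n ⟩
    κ m n * (ι - nat m + nat n)
      ≡⟨ cong (κ m n *_) (shift⁻ ι (nat m) (nat n) _ _ (nat-suc m) (nat-suc n)) ⟨
    κ m n * (ι - nat (suc m) + nat (suc n)) ∎
    where open ≡-Reasoning

  κ-comm : ∀ m n → κ m n ≡ κ n m
  κ-comm zero    n       = sym (κ-zeroʳ n)
  κ-comm (suc m) zero    = refl
  κ-comm (suc m) (suc n) = κ-comm m n

  κ-sucʳ : ∀ m n → κ m (suc n) * (ι - nat m + nat n + 1ℚ) ≡ κ m n * (ι + nat m - nat n)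
  κ-sucʳ m n = reshape ι (nat m) (nat n) (κ m (suc n)) (κ m n)
    (subst₂ (λ x y → x * (ι + nat n - nat m + 1ℚ) ≡ y * (ι - nat n + nat m))
      (κ-comm (suc n) m) (κ-comm n m) (κ-sucˡ n m))
    where
    reshape : ∀ i m n k′ k → k′ * (i + n - m + 1ℚ) ≡ k * (i - n + m) →
      k′ * (i - m + n + 1ℚ) ≡ k * (i + m - n)
    reshape i m n k′ k eq = linear-combination eq (solve (i ∷ m ∷ n ∷ k′ ∷ k ∷ []) ring)

  κ-predʳ : ∀ m n → p n * κ m (pred n) ≡ p n * κ (suc m) n
  κ-predʳ m zero    = 0*≡0* p0≡0
  κ-predʳ m (suc n) = refl

  κ-predˡ : ∀ m n → p m * κ (pred m) n ≡ p m * κ m (suc n)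
  κ-predˡ zero    n = 0*≡0* p0≡0
  κ-predˡ (suc m) n = refl

  -- The discrete wave equation for the squared entries.

  W : ℕ → ℕ → ℚ
  W m n = κ m n * (Y m n * Y m n)

  0≤W : ∀ m n → 0ℚ ℚ.≤ W m n
  0≤W m n = 0≤*0≤ (0≤κ m n) (0≤square (Y m n))

  -- `W (suc m) n` and `W m (pred n)` lie on one diagonal and share their `κ`, so pairing them
  -- across the equation leaves a difference of squares, one factor of which the recursion of `Y`
  -- turns into a multiple of `Y m n`. `Y-lower` does the same for `W (pred m) n` and `W m (suc n)`.
  -- What remains is linear in the neighbours and collapses by the ladder relations, the corner
  -- entries `Y (suc m) (suc n)` and `Y (pred m) (pred n)` cancelling.
  W-wave : ∀ m n →
    W (suc m) n + p m * (p m * W (pred m) n) - (p m + p (suc m)) * W m n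
      ≡ W m (suc n) + p n * (p n * W m (pred n)) - (p n + p (suc n)) * W m n
  W-wave m n = wave ι (nat m) (nat n) (nat (suc m)) (nat (suc n)) (p m) (p (suc m)) (p n) (p (suc n))
    (κ m n) (κ (suc m) n) (κ m (suc n)) (κ (pred m) n) (κ m (pred n))
    (Y m n) (Y (suc m) n) (Y (pred m) n) (Y m (suc n)) (Y m (pred n))
    (Y (pred m) (pred n)) (Y (suc m) (suc n))
    (nat-suc m) (nat-suc n) (κ-sucˡ m n) (κ-sucʳ m n) (κ-predʳ m n) (κ-predˡ m n)
    refl (Y-lower m n) (Y-lower (suc m) n) (Y-lower-pred m (Y-lower m) n) (Y-pred m n) refl
    where
    wave : ∀ i m n m′ n′ pᵐ pᵐ′ pⁿ pⁿ′ k k⁺ k⁻ kᵘ kᵛ y c u b v w z →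
      m′ ≡ m + 1ℚ → n′ ≡ n + 1ℚ →
      k⁺ * (i + m - n + 1ℚ) ≡ k * (i - m + n) →
      k⁻ * (i - m + n + 1ℚ) ≡ k * (i + m - n) →
      pⁿ * kᵛ ≡ pⁿ * k⁺ → pᵐ * kᵘ ≡ pᵐ * k⁻ →
      c ≡ (i + m + 1ℚ - n) * y + pⁿ * v →
      pᵐ * u - b ≡ (i - m + n + 1ℚ) * y →
      pᵐ′ * y - z ≡ (i - m′ + n + 1ℚ) * c →
      pⁿ * (pᵐ * w - y) ≡ pⁿ * ((i - m + n) * v) →
      pᵐ * ((i + m - n) * u + pⁿ * w) ≡ pᵐ * y →
      z ≡ (i + m + 1ℚ - n′) * b + pⁿ′ * y →
      k⁺ * (c * c) + pᵐ * (pᵐ * (kᵘ * (u * u))) - (pᵐ + pᵐ′) * (k * (y * y))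
        ≡ k⁻ * (b * b) + pⁿ * (pⁿ * (kᵛ * (v * v))) - (pⁿ + pⁿ′) * (k * (y * y))
    wave i m n .(m + 1ℚ) .(n + 1ℚ) pᵐ pᵐ′ pⁿ pⁿ′ k k⁺ k⁻ kᵘ kᵛ y c u b v w z
      refl refl k⁺-eq k⁻-eq kᵛ-eq kᵘ-eq c-eq lower lower′ lower-pred rec-pred z-eq =
      linear-combination
        ( (k⁺ * (c + pⁿ * v)) ⊛ c-eq ⊕ (k⁻ * (pᵐ * u + b)) ⊛ lower
        ⊕ (y * (c + pⁿ * v)) ⊛ k⁺-eq ⊕ (y * (pᵐ * u + b)) ⊛ k⁻-eq
        ⊕ (- (pⁿ * v * v)) ⊛ kᵛ-eq ⊕ (pᵐ * u * u) ⊛ kᵘ-eq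
        ⊕ (- (k * y)) ⊛ lower′ ⊕ (- (k * y)) ⊛ lower-pred ⊕ (k * y) ⊛ rec-pred ⊕ (- (k * y)) ⊛ z-eq)
        (solve (i ∷ m ∷ n ∷ pᵐ ∷ pᵐ′ ∷ pⁿ ∷ pⁿ′ ∷ k ∷ k⁺ ∷ k⁻ ∷ kᵘ ∷ kᵛ
          ∷ y ∷ c ∷ u ∷ b ∷ v ∷ w ∷ z ∷ []) ring)

  -- The dual scaling κ Y satisfies the lowering recursion with homogeneous data in column D + 1.
  W-boundary : i ≤ D → ∀ m → W m (suc D) ≡ 0ℚ
  W-boundary i≤D m = trans (assoc (κ m (suc D)) (Y m (suc D)))
    (trans (cong (_* Y m (suc D)) (X≡0 m)) (ℚ.*-zeroˡ (Y m (suc D))))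
    where
    assoc : ∀ k y → k * (y * y) ≡ k * y * y
    assoc = solve-∀ ring
    X≡0 : ∀ m → κ m (suc D) * Y m (suc D) ≡ 0ℚ
    X≡0 zero    = trans (cong (_* Y 0 (suc D)) (h-vanish (s≤s i≤D))) (ℚ.*-zeroˡ (Y 0 (suc D)))
    X≡0 (suc m) = step ι (nat m) (nat (suc D)) (κ m (suc D)) (κ (suc m) (suc D))
      (Y m (suc D)) (p (suc D)) (Y m D)
      (κ-sucˡ m (suc D)) p[1+D]≡0 (X≡0 m)
      where
      step : ∀ i m n k k′ y pₙ v → k′ * (i + m - n + 1ℚ) ≡ k * (i - m + n) → pₙ ≡ 0ℚ → k * y ≡ 0ℚ →
        k′ * ((i + m + 1ℚ - n) * y + pₙ * v) ≡ 0ℚ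
      step i m n k k′ y .0ℚ v k-eq refl x≡0 = linear-combination
        (y ⊛ k-eq ⊕ (i - m + n) ⊛ x≡0)
        (solve (i ∷ m ∷ n ∷ k ∷ k′ ∷ y ∷ v ∷ []) ring)

  -- The first row and its factorial moments.

  W-first-row : ∀ n → W 0 (suc n) ≡ W 0 n * ((ι - nat n) * (ι + nat n + 1ℚ))
  W-first-row n = step ι (nat n) (h n) (h (suc n)) (Y 0 n) (h-suc n)
    where
    step : ∀ i n k k′ y → k′ * (i + n + 1ℚ) ≡ k * (i - n) →
      k′ * ((- (i + n + 1ℚ) * y) * (- (i + n + 1ℚ) * y)) ≡ k * (y * y) * ((i - n) * (i + n + 1ℚ))
    step i n k k′ y eq = linear-combination (((i + n + 1ℚ) * y * y) ⊛ eq)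
      (solve (i ∷ n ∷ k ∷ k′ ∷ y ∷ []) ring)

  -- s n = (−i)ₙ (i+1)ₙ / (n! (−D)ₙ), which makes A-suc a form of the Chu–Vandermonde summation.
  s : ℕ → ℚ
  s n = W 0 n * r n

  0≤s : ∀ n → n ≤ D → 0ℚ ℚ.≤ s n
  0≤s n n≤D = 0≤*0≤ (0≤W 0 n) (ℚ.<⇒≤ (0<r n≤D))

  s-suc : ∀ {n} → n < D → s (suc n) * p (suc n) ≡ s n * ((ι - nat n) * (ι + nat n + 1ℚ))
  s-suc {n} n<D = step (W 0 (suc n)) (W 0 n) ((ι - nat n) * (ι + nat n + 1ℚ)) (r (suc n)) (r n) (p (suc n))
    (W-first-row n) (r-suc n<D)
    where
    step : ∀ w′ w x r′ r p′ → w′ ≡ w * x → r′ * p′ ≡ r → w′ * r′ * p′ ≡ w * r * x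
    step .(w * x) w x r′ .(r′ * p′) p′ refl refl = solve (w ∷ x ∷ r′ ∷ p′ ∷ []) ring

  -- Continues the first row one step past `D`, where `W-boundary` makes it vanish; this is the end
  -- term of the telescoping sum in `A-suc`.
  s-boundary : i ≤ D → s D * ((ι - nat D) * (ι + nat D + 1ℚ)) ≡ 0ℚ
  s-boundary i≤D = step (W 0 D) (r D) ((ι - nat D) * (ι + nat D + 1ℚ))
    (trans (sym (W-first-row D)) (W-boundary i≤D 0))
    where
    step : ∀ w r x → w * x ≡ 0ℚ → w * r * x ≡ 0ℚ
    step w r x eq = linear-combination (r ⊛ eq) (solve (w ∷ r ∷ x ∷ []) ring)

  -- Up to sign, the factorial moments of the weights `s`. `A 0` turns out to be the common row sum
  -- that normalises the stochastic matrix.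
  A : ℕ → ℚ
  A k = sumUpTo (λ n → s n * poch (- nat n) k) D

  0<A0 : 0ℚ ℚ.< A 0
  0<A0 = ℚ.<-≤-trans (ℚ.positive⁻¹ 1ℚ)
    (head≤sum (λ n → s n * 1ℚ) D (λ n n≤D → 0≤*0≤ (0≤s n n≤D) (ℚ.nonNegative⁻¹ 1ℚ)))

  A-suc : i ≤ D → ∀ k →
    A (suc k) * (nat D + 1ℚ + 1ℚ + nat k) ≡ A k * ((- ι + nat k) * (ι + 1ℚ + nat k))
  A-suc i≤D k = difference (A (suc k)) (A k) α β (begin
    α * A (suc k) + (- β) * A k
      ≡⟨ sum-linear₂ α (- β) (f (suc k)) (f k) D ⟨
    sumUpTo (λ n → α * f (suc k) n + (- β) * f k n) D
      ≡⟨ sum-telescope G D telescopes ⟩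
    G (suc D) - G 0
      ≡⟨ cong (λ x → x * poch (- nat D) k - 0ℚ) (s-boundary i≤D) ⟩
    0ℚ * poch (- nat D) k - 0ℚ
      ≡⟨ vanish (poch (- nat D) k) ⟩
    0ℚ ∎)
    where
    open ≡-Reasoning
    α = nat D + 1ℚ + 1ℚ + nat k
    β = (- ι + nat k) * (ι + 1ℚ + nat k)
    f : ℕ → ℕ → ℚ
    f k n = s n * poch (- nat n) k
    -- The telescoping certificate, written through the preceding weight so that its value at
    -- `suc D` is zero by `s-boundary`; `G-closed` rewrites it through `s n` to match the summand.
    G : ℕ → ℚ
    G zero    = 0ℚ
    G (suc n) = s n * ((ι - nat n) * (ι + nat n + 1ℚ)) * poch (- nat n) k
    vanish : ∀ x → 0ℚ * x - 0ℚ ≡ 0ℚ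
    vanish = solve-∀ ring
    difference : ∀ x y a b → a * x + (- b) * y ≡ 0ℚ → x * a ≡ y * b
    difference x y a b eq = linear-combination eq (solve (x ∷ y ∷ a ∷ b ∷ []) ring)
    G-closed : ∀ n → n ≤ D → G n ≡ s n * (nat n - 1ℚ - nat D) * (poch (- nat n) k * (- nat n + nat k))
    G-closed zero    _   = sym (trans
      (cong (s 0 * (0ℚ - 1ℚ - nat D) *_) (poch-zero k))
      (ℚ.*-zeroʳ (s 0 * (0ℚ - 1ℚ - nat D))))
    G-closed (suc n) n<D = step (nat D) (nat (suc n)) (nat k) (s (suc n)) (s n) ((ι - nat n) * (ι + nat n + 1ℚ))
      (poch (- nat n) k) (poch (- nat (suc n)) k) (s-suc n<D) (poch-shift-neg n k)
      where
      step : ∀ d n k s′ s x φ φ⁺ → s′ * (n * (d + 1ℚ - n)) ≡ s * x → φ⁺ * (- n + k) ≡ - n * φ →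
        s * x * φ ≡ s′ * (n - 1ℚ - d) * (φ⁺ * (- n + k))
      step d n k s′ s x φ φ⁺ s-eq shift = linear-combination
        ((- φ) ⊛ s-eq ⊕ (s′ * (d + 1ℚ - n)) ⊛ shift)
        (solve (d ∷ n ∷ k ∷ s′ ∷ s ∷ x ∷ φ ∷ φ⁺ ∷ []) ring)
    telescopes : ∀ n → n ≤ D → α * f (suc k) n + (- β) * f k n ≡ G (suc n) - G n
    telescopes n n≤D = trans (step ι (nat D) (nat n) (nat k) (s n) (poch (- nat n) k))
      (cong (λ x → G (suc n) - x) (sym (G-closed n n≤D)))
      where
      step : ∀ i d n k s φ →
        (d + 1ℚ + 1ℚ + k) * (s * (φ * (- n + k))) + (- ((- i + k) * (i + 1ℚ + k))) * (s * φ)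
          ≡ s * ((i - n) * (i + n + 1ℚ)) * φ - s * (n - 1ℚ - d) * (φ * (- n + k))
      step = solve-∀ ring

  A-closed : i ≤ D → ∀ k →
    A k * poch (nat (suc (suc D))) k ≡ A 0 * (poch (- ι) k * poch (nat (suc i)) k)
  A-closed i≤D zero    = cong (A 0 *_) (sym (ℚ.*-identityʳ 1ℚ))
  A-closed i≤D (suc k) = step ι (nat (suc i)) (nat D) (nat (suc D)) (nat (suc (suc D))) (nat k)
    (A (suc k)) (A k) (A 0) (poch (nat (suc (suc D))) k) (poch (- ι) k) (poch (nat (suc i)) k)
    (nat-suc i) (nat-suc D) (nat-suc (suc D)) (A-suc i≤D k) (A-closed i≤D k)
    where
    step : ∀ i i′ d d′ d″ k a′ a a₀ g u v → i′ ≡ i + 1ℚ → d′ ≡ d + 1ℚ → d″ ≡ d′ + 1ℚ →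
      a′ * (d + 1ℚ + 1ℚ + k) ≡ a * ((- i + k) * (i + 1ℚ + k)) →
      a * g ≡ a₀ * (u * v) →
      a′ * (g * (d″ + k)) ≡ a₀ * (u * (- i + k) * (v * (i′ + k)))
    step i .(i + 1ℚ) d .(d + 1ℚ) .(d + 1ℚ + 1ℚ) k a′ a a₀ g u v refl refl refl rec closed =
      linear-combination
        (g ⊛ rec ⊕ ((- i + k) * (i + 1ℚ + k)) ⊛ closed)
        (solve (i ∷ d ∷ k ∷ a′ ∷ a ∷ a₀ ∷ g ∷ u ∷ v ∷ []) ring)

-- The Chebyshev polynomial as eigenvector, and its eigenvalue.

module Eigenvalue (D i j : ℕ) (i≤D : i ≤ D) (j≤D : j ≤ D) where

  open Grid D
  open Chebyshev D j
  open Kernel D i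

  -- v m = P m · (W̃ t)(m) for the stochastic matrix W̃ up to scale, W̃ m n = W m n / (P m · P n).
  v : ℕ → ℚ
  v m = sumUpTo (λ n → W m n * (r n * t n)) D

  -- Summation by parts: `W-wave` moves the operator from the row variable to the column variable,
  -- and there onto `t`, where `t-eigen` applies. Both boundary terms vanish.
  v-recurrence : ∀ m → (Λ - p (suc m) - p m) * v m + 1ℚ * v (suc m) + p m * p m * v (pred m) ≡ 0ℚ
  v-recurrence m = begin
    α * v m + 1ℚ * v (suc m) + p m * p m * v (pred m)
      ≡⟨ sum-linear₃ α 1ℚ (p m * p m) (f m) (f (suc m)) (f (pred m)) D ⟨
    sumUpTo (λ n → α * f m n + 1ℚ * f (suc m) n + p m * p m * f (pred m) n) D
      ≡⟨ sum-telescope G D telescopes ⟩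
    G (suc D) - G 0
      ≡⟨ vanish (r D) (t D) (t (suc D)) (W m D) (W m (suc D)) (p (suc D)) (W-boundary i≤D m) p[1+D]≡0 ⟩
    0ℚ ∎
    where
    open ≡-Reasoning
    α = Λ - p (suc m) - p m
    f : ℕ → ℕ → ℚ
    f m n = W m n * (r n * t n)
    -- The weighted discrete Wronskian of `t` and row `m`. At `suc D` it is zero because
    -- `W m (suc D)` and `p (suc D)` are.
    G : ℕ → ℚ
    G zero    = 0ℚ
    G (suc n) = r n * (t n * W m (suc n) - p (suc n) * W m n * t (suc n))
    vanish : ∀ r t t′ w w′ p → w′ ≡ 0ℚ → p ≡ 0ℚ → r * (t * w′ - p * w * t′) - 0ℚ ≡ 0ℚ
    vanish r t t′ w .0ℚ .0ℚ refl refl = solve (r ∷ t ∷ t′ ∷ w ∷ []) ring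
    G-closed : ∀ n → n ≤ D → G n ≡ p n * r n * (t (pred n) * W m n - p n * W m (pred n) * t n)
    G-closed zero    _   = sym (annihilate (p 0) (r 0) (t 0 * W m 0 - p 0 * W m 0 * t 0) p0≡0)
      where
      annihilate : ∀ p r x → p ≡ 0ℚ → p * r * x ≡ 0ℚ
      annihilate .0ℚ r x refl = solve (r ∷ x ∷ []) ring
    G-closed (suc n) n<D = cong (_* (t n * W m (suc n) - p (suc n) * W m n * t (suc n)))
      (trans (sym (r-suc n<D)) (ℚ.*-comm (r (suc n)) (p (suc n))))
    telescopes : ∀ n → n ≤ D → α * f m n + 1ℚ * f (suc m) n + p m * p m * f (pred m) n ≡ G (suc n) - G n
    telescopes n n≤D = trans
      (step Λ (p m) (p (suc m)) (p n) (p (suc n)) (r n) (t n) (t (suc n)) (t (pred n))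
        (W m n) (W (suc m) n) (W (pred m) n) (W m (suc n)) (W m (pred n)) (W-wave m n) (t-eigen j≤D n))
      (cong (λ x → G (suc n) - x) (sym (G-closed n n≤D)))
      where
      step : ∀ l pᵐ pᵐ′ pⁿ pⁿ′ r t t′ t⁻ w w₁ w₂ w₃ w₄ →
        w₁ + pᵐ * (pᵐ * w₂) - (pᵐ + pᵐ′) * w ≡ w₃ + pⁿ * (pⁿ * w₄) - (pⁿ + pⁿ′) * w →
        (l - pⁿ′ - pⁿ) * t + pⁿ′ * t′ + pⁿ * t⁻ ≡ 0ℚ →
        (l - pᵐ′ - pᵐ) * (w * (r * t)) + 1ℚ * (w₁ * (r * t)) + pᵐ * pᵐ * (w₂ * (r * t))
          ≡ r * (t * w₃ - pⁿ′ * w * t′) - pⁿ * r * (t⁻ * w - pⁿ * w₄ * t)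
      step l pᵐ pᵐ′ pⁿ pⁿ′ r t t′ t⁻ w w₁ w₂ w₃ w₄ wave eigen = linear-combination
        ((r * t) ⊛ wave ⊕ (w * r) ⊛ eigen)
        (solve (l ∷ pᵐ ∷ pᵐ′ ∷ pⁿ ∷ pⁿ′ ∷ r ∷ t ∷ t′ ∷ t⁻ ∷ w ∷ w₁ ∷ w₂ ∷ w₃ ∷ w₄ ∷ []) ring)

  v-eigen-pred : ∀ m → v (pred m) ≡ v 0 * (P (pred m) * t (pred m)) →
    p m * p m * v (pred m) ≡ p m * (v 0 * (P m * t (pred m)))
  v-eigen-pred zero    _  = trans (ℚ.*-assoc (p 0) (p 0) (v 0)) (0*≡0* p0≡0)
  v-eigen-pred (suc m) eq = step (p (suc m)) (v m) (v 0) (P m) (t m) eq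
    where
    step : ∀ p v v₀ P t → v ≡ v₀ * (P * t) → p * p * v ≡ p * (v₀ * (P * p * t))
    step p .(v₀ * (P * t)) v₀ P t refl = solve (p ∷ v₀ ∷ P ∷ t ∷ []) ring

  -- `v` and `P m * t m` obey the same three-term recurrence. As `p 0` is 0, the value at 0 alone
  -- determines a solution; two consecutive values are carried to make the induction go through.
  v-eigen-pair : ∀ m → v (pred m) ≡ v 0 * (P (pred m) * t (pred m)) × v m ≡ v 0 * (P m * t m)
  v-eigen-pair zero    = start , start
    where
    start : v 0 ≡ v 0 * (1ℚ * t 0)
    start = sym (trans (cong (λ x → v 0 * (1ℚ * x)) t0≡1) (ℚ.*-identityʳ (v 0)))
  v-eigen-pair (suc m) with v-eigen-pair m
  ... | eq⁻ , eq = eq , step Λ (p m) (p (suc m)) (v m) (v (suc m)) (v (pred m)) (v 0)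
    (P m) (t m) (t (suc m)) (t (pred m))
    (v-recurrence m) (t-eigen j≤D m) eq (v-eigen-pred m eq⁻)
    where
    step : ∀ l p p′ v v′ v⁻ v₀ P t t′ t⁻ →
      (l - p′ - p) * v + 1ℚ * v′ + p * p * v⁻ ≡ 0ℚ →
      (l - p′ - p) * t + p′ * t′ + p * t⁻ ≡ 0ℚ →
      v ≡ v₀ * (P * t) → p * p * v⁻ ≡ p * (v₀ * (P * t⁻)) →
      v′ ≡ v₀ * (P * p′ * t′)
    step l p p′ v v′ v⁻ v₀ P t t′ t⁻ rec eigen eq eq⁻ = linear-combination
      (rec ⊕ (- (v₀ * P)) ⊛ eigen ⊕ (- (l - p′ - p)) ⊛ eq ⊕ (- 1ℚ) ⊛ eq⁻)
      (solve (l ∷ p ∷ p′ ∷ v ∷ v′ ∷ v⁻ ∷ v₀ ∷ P ∷ t ∷ t′ ∷ t⁻ ∷ []) ring)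

  v-eigen : ∀ m → v m ≡ v 0 * (P m * t m)
  v-eigen m = proj₂ (v-eigen-pair m)

  T : ℕ → ℚ
  T = term4F3 (- nat i) (nat (suc i)) (- nat j) (nat (suc j)) 1ℚ (nat (suc (suc D))) (- nat D) 1ℚ

  T-vanish : ∀ k → i < k → T k ≡ 0ℚ
  T-vanish k i<k = trans (cong (λ x → div x den)
      (step (poch (- nat i) k) (poch (nat (suc i)) k) (poch (- nat j) k) (poch (nat (suc j)) k) (pow 1ℚ k) (poch-vanish i<k)))
    (div-zeroˡ den)
    where
    den = poch 1ℚ k * poch (nat (suc (suc D))) k * poch (- nat D) k * fact k
    step : ∀ a b c d e → a ≡ 0ℚ → a * b * c * d * e ≡ 0ℚ
    step .0ℚ b c d e refl = solve (b ∷ c ∷ d ∷ e ∷ []) ring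

  -- The closed forms of `c k` and `A k` supply complementary factors of the hypergeometric term;
  -- the common denominator is nonzero because `k ≤ j ≤ D`.
  c*A≡A0*T : ∀ k → k ≤ j → c k * A k ≡ A 0 * T k
  c*A≡A0*T k k≤j = *-cancelʳ den≢0
    (step (c k) (A k) (A 0) (T k) (poch 1ℚ k) (poch (nat (suc (suc D))) k) (poch (- nat D) k)
      (poch (- nat i) k) (poch (nat (suc i)) k) (poch (- nat j) k) (poch (nat (suc j)) k) (pow 1ℚ k)
      (c-closed (ℕ.≤-trans k≤j j≤D)) (A-closed i≤D k) (div-* _ den≢0) (pow-1 k))
    where
    den = poch 1ℚ k * poch (nat (suc (suc D))) k * poch (- nat D) k * fact k
    fact≢0 : fact k ≢ 0ℚ
    fact≢0 = >⇒≢ (0<poch (ℚ.positive⁻¹ 1ℚ) k)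
    den≢0 : den ≢ 0ℚ
    den≢0 = *-≢0 (*-≢0 (*-≢0 fact≢0 (>⇒≢ (0<poch (0<nat-suc (suc D)) k))) (poch-D≢0 (ℕ.≤-trans k≤j j≤D))) fact≢0
    step : ∀ c a a₀ t f g h x y z w e →
      c * (f * h * f) ≡ z * w → a * g ≡ a₀ * (x * y) →
      t * (f * g * h * f) ≡ x * y * z * w * e → e ≡ 1ℚ →
      c * a * (f * g * h * f) ≡ a₀ * t * (f * g * h * f)
    step c a a₀ t f g h x y z w .1ℚ c-eq a-eq t-eq refl = linear-combination
      ((a * g) ⊛ c-eq ⊕ (z * w) ⊛ a-eq ⊕ (- a₀) ⊛ t-eq)
      (solve (c ∷ a ∷ a₀ ∷ t ∷ f ∷ g ∷ h ∷ x ∷ y ∷ z ∷ w ∷ []) ring)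

  -- Expanding `t` and exchanging the sums leaves the moments `A k` of the first row, weighted by
  -- `c k`.
  v0≡A0*F : v 0 ≡ A 0 * F D i j
  v0≡A0*F = begin
    v 0
      ≡⟨ sum-cong D (λ n _ → expand n) ⟩
    sumUpTo (λ n → sumUpTo (λ k → s n * (c k * poch (- nat n) k)) j) D
      ≡⟨ sum-swap (λ n k → s n * (c k * poch (- nat n) k)) D j ⟩
    sumUpTo (λ k → sumUpTo (λ n → s n * (c k * poch (- nat n) k)) D) j
      ≡⟨ sum-cong j (λ k _ → collect k) ⟩
    sumUpTo (λ k → c k * A k) j
      ≡⟨ sum-cong j c*A≡A0*T ⟩
    sumUpTo (λ k → A 0 * T k) j
      ≡⟨ sum-*ˡ (A 0) T j ⟩
    A 0 * sumUpTo T j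
      ≡⟨ cong (A 0 *_) (sum-⊓ T i j T-vanish) ⟨
    A 0 * F D i j ∎
    where
    open ≡-Reasoning
    expand : ∀ n → W 0 n * (r n * t n) ≡ sumUpTo (λ k → s n * (c k * poch (- nat n) k)) j
    expand n = trans (sym (ℚ.*-assoc (W 0 n) (r n) (t n)))
      (sym (sum-*ˡ (s n) (λ k → c k * poch (- nat n) k) j))
    exchange : ∀ a b c → a * (b * c) ≡ b * (a * c)
    exchange = solve-∀ ring
    collect : ∀ k → sumUpTo (λ n → s n * (c k * poch (- nat n) k)) D ≡ c k * A k
    collect k = trans (sum-cong D (λ n _ → exchange (s n) (c k) (poch (- nat n) k)))
      (sum-*ˡ (c k) (λ n → s n * poch (- nat n) k) D)


-- Row sums and the maximum principle.

module _ (D i : ℕ) (i≤D : i ≤ D) where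

  open Grid D
  open Kernel D i

  -- The eigenvector statement for `j = 0`, where `t` is the constant 1 and `v 0` is `A 0`.
  row-sum : ∀ m → sumUpTo (λ n → W m n * r n) D ≡ A 0 * P m
  row-sum m = begin
    sumUpTo (λ n → W m n * r n) D              ≡⟨ sum-cong D (λ n _ → unit (W m n) (r n)) ⟩
    Constant.v m                               ≡⟨ Constant.v-eigen m ⟩
    Constant.v 0 * (P m * (1ℚ * 1ℚ))           ≡⟨ cong₂ _*_ (sum-cong D (λ n _ → ℚ.*-assoc (W 0 n) (r n) 1ℚ))
                                                         (sym (ℚ.*-identityʳ (P m))) ⟨
    A 0 * P m                                  ∎
    where
    open ≡-Reasoning
    module Constant = Eigenvalue D i 0 i≤D z≤n
    unit : ∀ w r → w * r ≡ w * (r * (1ℚ * 1ℚ))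
    unit = solve-∀ ring

  -- Maximum principle: at an index `k` where `∣ t k ∣` is largest, the eigenvector equation bounds
  -- `∣ F D i j ∣` times the row sum times `∣ t k ∣` by the row sum times `∣ t k ∣`.
  ∣F∣≤1 : ∀ j → j ≤ D → ∣ F D i j ∣ ℚ.≤ 1ℚ
  ∣F∣≤1 j j≤D with argmax (λ m → ∣ Chebyshev.t D j m ∣) D
  ... | k , k≤D , max = ℚ.*-cancelʳ-≤-pos (A 0 * P k * ∣ t k ∣) {{positive (0<*0< 0<A0*P 0<∣t∣)}} (begin
    ∣ F D i j ∣ * (A 0 * P k * ∣ t k ∣)              ≡⟨ factor ⟩
    ∣ v k ∣                                          ≤⟨ ∣sum∣≤sum∣∣ (λ n → W k n * (r n * t n)) D ⟩
    sumUpTo (λ n → ∣ W k n * (r n * t n) ∣) D        ≤⟨ sum-mono D bound ⟩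
    sumUpTo (λ n → ∣ t k ∣ * (W k n * r n)) D        ≡⟨ sum-*ˡ ∣ t k ∣ (λ n → W k n * r n) D ⟩
    ∣ t k ∣ * sumUpTo (λ n → W k n * r n) D          ≡⟨ cong (∣ t k ∣ *_) (row-sum k) ⟩
    ∣ t k ∣ * (A 0 * P k)                            ≡⟨ rearrange ∣ t k ∣ (A 0 * P k) ⟩
    1ℚ * (A 0 * P k * ∣ t k ∣)                       ∎)
    where
    open ℚ.≤-Reasoning
    open Chebyshev D j using (t; t0≡1)
    open Eigenvalue D i j i≤D j≤D using (v; v-eigen; v0≡A0*F)
    rearrange : ∀ x y → x * y ≡ 1ℚ * (y * x)
    rearrange = solve-∀ ring
    0<A0*P : 0ℚ ℚ.< A 0 * P k
    0<A0*P = 0<*0< 0<A0 (0<P k≤D)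
    0<∣t∣ : 0ℚ ℚ.< ∣ t k ∣
    -- The maximum is at least `∣ t 0 ∣`, which is 1, so it can be cancelled.
    0<∣t∣ = ℚ.<-≤-trans (subst (λ x → 0ℚ ℚ.< ∣ x ∣) (sym t0≡1) (ℚ.positive⁻¹ 1ℚ)) (max 0 z≤n)
    0≤W*r : ∀ n → n ≤ D → 0ℚ ℚ.≤ W k n * r n
    0≤W*r n n≤D = 0≤*0≤ (0≤W k n) (ℚ.<⇒≤ (0<r n≤D))
    bound : ∀ n → n ≤ D → ∣ W k n * (r n * t n) ∣ ℚ.≤ ∣ t k ∣ * (W k n * r n)
    bound n n≤D = begin
      ∣ W k n * (r n * t n) ∣      ≡⟨ cong ∣_∣ (ℚ.*-assoc (W k n) (r n) (t n)) ⟨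
      ∣ W k n * r n * t n ∣        ≡⟨ ℚ.∣p*q∣≡∣p∣*∣q∣ (W k n * r n) (t n) ⟩
      ∣ W k n * r n ∣ * ∣ t n ∣    ≡⟨ cong (_* ∣ t n ∣) (ℚ.0≤p⇒∣p∣≡p (0≤W*r n n≤D)) ⟩
      W k n * r n * ∣ t n ∣        ≤⟨ ℚ.*-monoˡ-≤-nonNeg (W k n * r n) {{nonNegative (0≤W*r n n≤D)}} (max n n≤D) ⟩
      W k n * r n * ∣ t k ∣        ≡⟨ ℚ.*-comm (W k n * r n) ∣ t k ∣ ⟩
      ∣ t k ∣ * (W k n * r n)      ∎
    factor : ∣ F D i j ∣ * (A 0 * P k * ∣ t k ∣) ≡ ∣ v k ∣
    factor = begin-equality
      ∣ F D i j ∣ * (A 0 * P k * ∣ t k ∣)      ≡⟨ cong (λ x → ∣ F D i j ∣ * (x * ∣ t k ∣)) (ℚ.0≤p⇒∣p∣≡p (ℚ.<⇒≤ 0<A0*P)) ⟨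
      ∣ F D i j ∣ * (∣ A 0 * P k ∣ * ∣ t k ∣)  ≡⟨ cong (∣ F D i j ∣ *_) (ℚ.∣p*q∣≡∣p∣*∣q∣ (A 0 * P k) (t k)) ⟨
      ∣ F D i j ∣ * ∣ A 0 * P k * t k ∣        ≡⟨ ℚ.∣p*q∣≡∣p∣*∣q∣ (F D i j) (A 0 * P k * t k) ⟨
      ∣ F D i j * (A 0 * P k * t k) ∣          ≡⟨ cong ∣_∣ (regroup (F D i j) (A 0) (P k) (t k)) ⟩
      ∣ A 0 * F D i j * (P k * t k) ∣          ≡⟨ cong (λ x → ∣ x * (P k * t k) ∣) v0≡A0*F ⟨
      ∣ v 0 * (P k * t k) ∣                    ≡⟨ cong ∣_∣ (v-eigen k) ⟨
      ∣ v k ∣                                  ∎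
      where
      regroup : ∀ f a p t → f * (a * p * t) ≡ a * f * (p * t)
      regroup = solve-∀ ring

theorem1p3 : ∀ (D i j : ℕ) → 1 ≤ D → i ≤ D → j ≤ D →
    ∣ F D i j ∣ ℚ.≤ 1ℚ
theorem1p3 D i j _ i≤D j≤D = ∣F∣≤1 D i i≤D j j≤D
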